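{- VERTEX COLORING can be solved in polynomial time for the class of $(4K_1, C_4, C_6)$-free graphs that contain a $C_7$ as an induced subgraph. That is, there is an algorithm which, given any $(4K_1, C_4, C_6)$-free graph $G$ containing an induced $C_7$, determines the chromatic number $\chi(G)$ in time polynomial in the size of $G$.
   Context: Graphs are finite, simple and undirected. For a set $L$ of graphs, a graph is $L$-free if it contains no graph of $L$ as an induced subgraph. $C_k$ denotes the chordless cycle on $k$ vertices, and $4K_1$ denotes the graph with four vertices and no edges. A coloring of a graph $G=(V,E)$ is a mapping $f: V \to \{1,\ldots,k\}$ for some nonnegative integer $k$ such that $f(u)\neq f(v)$ whenever $uv \in E$. The chromatic number $\chi(G)$ is the minimum number of colors needed to color $G$. VERTEX COLORING is the problem of determining the chromatic number of a graph. -}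

module Defs where

open import Data.Bool using (Bool; true; false; T; _∨_; _∧_; if_then_else_)
open import Data.Bool.Properties using (∨-comm; ∧-zeroʳ)
open import Data.Fin using (Fin; toℕ)
open import Data.List using (List; []; _∷_; allFin; cartesianProductWith)
open import Data.List.Relation.Unary.All using (All)
open import Data.Nat using (ℕ; zero; suc; _+_; _∸_; _*_; _^_; _≤_; _≤?_; _≡ᵇ_)
open import Data.Product using (Σ; ∃-syntax; _×_)
open import Function.Definitions using (Injective)
open import Level using (0ℓ)
open import Relation.Binary.PropositionalEquality using (_≡_; _≢_; refl)
open import Relation.Nullary using (¬_)
open import Relation.Nullary.Decidable using (True)
open import Relation.Unary using (Pred)

------------------------------------------------------------------------
-- Graphs

record Graph : Set where
  field
    order  : ℕ
    adj    : Fin order → Fin order → Bool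
    sym    : ∀ u v → adj u v ≡ adj v u
    irrefl : ∀ v → adj v v ≡ false

  Vertex : Set
  Vertex = Fin order

open Graph public using (order; adj; Vertex)

infix 4 _⊑_

-- H ⊑ G: some induced subgraph of G is isomorphic to H.
_⊑_ : Graph → Graph → Set
H ⊑ G = Σ (Vertex H → Vertex G) λ f →
  Injective _≡_ _≡_ f × (∀ u v → adj H u v ≡ adj G (f u) (f v))

Free : List Graph → Graph → Set
Free L G = All (λ H → ¬ (H ⊑ G)) L

infix 10 _K₁

_K₁ : ℕ → Graph
n K₁ = record
  { order  = n
  ; adj    = λ _ _ → false
  ; sym    = λ _ _ → refl
  ; irrefl = λ _ → refl
  }

-- On 0, …, k-1, the successor of i is i + 1, except that the successor
-- of k - 1 is 0.
isNext : (k : ℕ) → Fin k → Fin k → Bool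
isNext k i j =
  (suc (toℕ i) ≡ᵇ toℕ j) ∨ ((suc (toℕ i) ≡ᵇ k) ∧ (toℕ j ≡ᵇ 0))

private
  suc≢ᵇ : ∀ n → (suc n ≡ᵇ n) ≡ false
  suc≢ᵇ zero    = refl
  suc≢ᵇ (suc n) = suc≢ᵇ n

  isNext-irrefl : ∀ k → {True (3 ≤? k)} → ∀ i → isNext k i i ≡ false
  isNext-irrefl (suc (suc (suc k))) Fin.zero = refl
  isNext-irrefl (suc (suc (suc k))) (Fin.suc i)
    rewrite suc≢ᵇ (toℕ i) = ∧-zeroʳ _

C : (k : ℕ) → {True (3 ≤? k)} → Graph
C k {k≥3} = record
  { order  = k
  ; adj    = λ i j → isNext k i j ∨ isNext k j i
  ; sym    = λ i j → ∨-comm (isNext k i j) (isNext k j i)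
  ; irrefl = λ i → irr i
  }
  where
  irr : ∀ i → (isNext k i i ∨ isNext k i i) ≡ false
  irr i rewrite isNext-irrefl k {k≥3} i = refl

------------------------------------------------------------------------
-- Coloring

IsColoring : (G : Graph) (k : ℕ) → (Vertex G → Fin k) → Set
IsColoring G k f = ∀ u v → T (adj G u v) → f u ≢ f v

Colorable : Graph → ℕ → Set
Colorable G k = Σ (Vertex G → Fin k) (IsColoring G k)

IsChromaticNumber : Graph → ℕ → Set
IsChromaticNumber G k = Colorable G k × (∀ j → Colorable G j → k ≤ j)

------------------------------------------------------------------------
-- Algorithms
--
-- The model is a random access machine with structured control: finitely
-- many variables (those occurring in the program) and a memory indexed by
-- ℕ, with addition and truncated subtraction.  Every syntax node evaluated
-- costs one unit.  There is no multiplication or shift instruction, so in t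
-- steps numbers grow by at most O(t) bits, and time in this model is
-- polynomially related to Turing machine time.

infixl 6 _⊕_ _⊖_

data Expr : Set where
  lit     : ℕ → Expr
  var     : ℕ → Expr
  mem[_]  : Expr → Expr
  _⊕_ _⊖_ : Expr → Expr → Expr

infixr 2 _⨾_
infix  3 _≔_ mem[_]≔_

data Program : Set where
  skip          : Program
  _≔_           : ℕ → Expr → Program
  mem[_]≔_      : Expr → Expr → Program
  _⨾_           : Program → Program → Program
  IF_THEN_ELSE_ : Expr → Program → Program → Program
  WHILE_DO_     : Expr → Program → Program

record Store : Set where
  constructor store
  field
    vars : ℕ → ℕ
    mem  : ℕ → ℕ

open Store public

_[_↦_] : (ℕ → ℕ) → ℕ → ℕ → (ℕ → ℕ)
(f [ a ↦ v ]) b = if a ≡ᵇ b then v else f b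

⟦_⟧ : Expr → Store → ℕ
⟦ lit n    ⟧ s = n
⟦ var x    ⟧ s = vars s x
⟦ mem[ e ] ⟧ s = mem s (⟦ e ⟧ s)
⟦ e ⊕ e′   ⟧ s = ⟦ e ⟧ s + ⟦ e′ ⟧ s
⟦ e ⊖ e′   ⟧ s = ⟦ e ⟧ s ∸ ⟦ e′ ⟧ s

cost : Expr → ℕ
cost (lit n)  = 1
cost (var x)  = 1
cost mem[ e ] = 1 + cost e
cost (e ⊕ e′) = 1 + cost e + cost e′
cost (e ⊖ e′) = 1 + cost e + cost e′

infix 1 ⟨_,_⟩⇓[_]_

-- ⟨ p , s ⟩⇓[ t ] s′: started in s, the program p halts in s′ after exactly
-- t steps.  In tests, 0 is false and every other number is true.
data ⟨_,_⟩⇓[_]_ : Program → Store → ℕ → Store → Set where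

  ⇓skip : ∀ {s} → ⟨ skip , s ⟩⇓[ 1 ] s

  ⇓var : ∀ {s x e} →
    ⟨ x ≔ e , s ⟩⇓[ 1 + cost e ] store (vars s [ x ↦ ⟦ e ⟧ s ]) (mem s)

  ⇓mem : ∀ {s a e} →
    ⟨ mem[ a ]≔ e , s ⟩⇓[ 1 + cost a + cost e ]
      store (vars s) (mem s [ ⟦ a ⟧ s ↦ ⟦ e ⟧ s ])

  ⇓seq : ∀ {s s′ s″ p q t u} →
    ⟨ p , s ⟩⇓[ t ] s′ → ⟨ q , s′ ⟩⇓[ u ] s″ →
    ⟨ p ⨾ q , s ⟩⇓[ t + u ] s″

  ⇓then : ∀ {s s′ e p q t} → ⟦ e ⟧ s ≢ 0 →
    ⟨ p , s ⟩⇓[ t ] s′ →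
    ⟨ IF e THEN p ELSE q , s ⟩⇓[ 1 + cost e + t ] s′

  ⇓else : ∀ {s s′ e p q t} → ⟦ e ⟧ s ≡ 0 →
    ⟨ q , s ⟩⇓[ t ] s′ →
    ⟨ IF e THEN p ELSE q , s ⟩⇓[ 1 + cost e + t ] s′

  ⇓stop : ∀ {s e p} → ⟦ e ⟧ s ≡ 0 →
    ⟨ WHILE e DO p , s ⟩⇓[ 1 + cost e ] s

  ⇓loop : ∀ {s s′ s″ e p t u} → ⟦ e ⟧ s ≢ 0 →
    ⟨ p , s ⟩⇓[ t ] s′ → ⟨ WHILE e DO p , s′ ⟩⇓[ u ] s″ →
    ⟨ WHILE e DO p , s ⟩⇓[ 1 + cost e + t + u ] s″

load : List ℕ → ℕ → ℕ
load []       a       = 0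
load (x ∷ xs) zero    = x
load (x ∷ xs) (suc a) = load xs a

-- The number of vertices, followed by the adjacency matrix row by row.
encode : Graph → List ℕ
encode G = order G ∷ cartesianProductWith
  (λ u v → if adj G u v then 1 else 0)
  (allFin (order G)) (allFin (order G))

initial : Graph → Store
initial G = store (λ _ → 0) (load (encode G))

output : Store → ℕ
output s = vars s 0

-- One program, and one polynomial c n ^ k + c in the number n of vertices
-- (every polynomial is dominated by one of this form), serve all the graphs
-- in the class; nothing is required of the program on other graphs.
SolvableInPolynomialTime : (Graph → ℕ → Set) → Pred Graph 0ℓ → Set
SolvableInPolynomialTime IsAnswer Class =
  Σ Program λ p → ∃[ c ] ∃[ k ] (∀ G → Class G →
    ∃[ t ] ∃[ s ] (⟨ p , initial G ⟩⇓[ t ] s)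
      × t ≤ c * order G ^ k + c
      × IsAnswer G (output s))

VertexColoring : Graph → ℕ → Set
VertexColoring = IsChromaticNumber

{-# OPTIONS --safe #-}

-- Let c be an induced C₇ of G, and let the pattern of a vertex v be the set
-- of all i such that c i is adjacent to v.  A finite check of the extensions
-- of C₇ by one and by two vertices shows that distinct vertices with the same
-- pattern are true twins.  So G arises from a graph with at most 2 ^ 7
-- vertices by substituting cliques for vertices, and a colouring is described
-- by the number x S of colours which occur exactly on the patterns in S: the
-- sets S with x S ≠ 0 have to be independent, and every pattern t must be the
-- pattern of at most Σ { x S ∣ t ∈ S } vertices.  The number of unknowns x S
-- does not depend on G, so trying all the values below the order of G takes
-- polynomial time.  The trial of all values of c and x is expressed as an
-- arithmetic term with sums over i < order G, which reduces the analysis of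
-- programs to a structural induction on such terms.

module Submission where

import Algebra.Properties.Semiring.Sum
open import Data.Bool using (Bool; true; false; T; if_then_else_)
import Data.Bool.Properties as Bool
open import Data.Fin using
  ( Fin; zero; suc; toℕ; fromℕ<; inject≤; splitAt; _↑ˡ_; _↑ʳ_; #_
  ; combine; funToFin; finToFun)
open import Data.Fin.Properties using
  ( _≟_; all?; any?; toℕ<n; toℕ-fromℕ<; suc-injective; injective⇒≤
  ; inject≤-injective; splitAt-↑ˡ; splitAt-↑ʳ; 2↔Bool; finToFun-funToFin
  ; funToFin-finToFin)
open import Data.Fin.Subset using (Subset; inside; outside)
open import Data.Fin.Subset.Properties using (anySubset?)
open import Data.List as List using (List; []; _∷_; cartesianProductWith)
open import Data.List.Membership.Propositional using (_∈_)
open import Data.List.Properties using (map-tabulate; length-map; length-tabulate)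
open import Data.List.Relation.Unary.All as All using (All)
open import Data.List.Relation.Unary.Any as Any using (Any; here; there)
open import Data.Nat using (ℕ; zero; suc; _+_; _*_; _∸_; _^_; _≤_; _<_; z≤n; s≤s; _≡ᵇ_)
open import Data.Nat.DivMod using (_mod_)
open import Data.Nat.Properties hiding (_≟_; suc-injective)
open import Data.Nat.Solver using (module +-*-Solver)
open import Data.Product using (∃; ∃-syntax; _×_; _,_; proj₁; proj₂)
open import Data.Sum using (_⊎_; inj₁; inj₂; [_,_]′)
open import Data.Unit using (tt)
open import Data.Vec using (Vec; []; _∷_; lookup; tabulate; _++_)
open import Data.Vec.Properties using (lookup∘tabulate; tabulate-cong; lookup-++ˡ; lookup-++ʳ; ≡-dec)
open import Function using (_∘_; id; Inverse; Equivalence)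
open import Function.Definitions using (Injective)
open import Relation.Binary.PropositionalEquality
open import Relation.Nullary using (¬_; Dec; does; yes; no; contradiction)
open import Relation.Nullary.Decidable using
  ( map′; _×-dec_; _→-dec_; ¬?; dec-true; decidable-stable; toWitness
  ; toWitnessFalse)
open import Defs

open +-*-Solver using (solve; _:+_; _:*_; _:=_; con)
open Algebra.Properties.Semiring.Sum +-*-semiring
  using (sum; sum-cong-≗; ∑-comm; *-distribʳ-sum)

-- Extensions of C₇

-- The map is a parameter here, whereas `_⊑_` hides it: for a given map the property is decidable by
-- inspection of all pairs.
Embeds : ∀ H G → (Vertex H → Vertex G) → Set
Embeds H G f =
  Injective _≡_ _≡_ f × (∀ u v → adj H u v ≡ adj G (f u) (f v))

⊑-trans : ∀ F G H → F ⊑ G → G ⊑ H → F ⊑ H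
⊑-trans _ _ _ (f , f-inj , f-adj) (g , g-inj , g-adj) =
  g ∘ f , f-inj ∘ g-inj , λ u v → trans (f-adj u v) (g-adj (f u) (f v))

Free-⊑ : ∀ {L} G H → G ⊑ H → Free L H → Free L G
Free-⊑ G H G⊑H =
  All.map λ {F} F⋢H F⊑G → F⋢H (⊑-trans F G H F⊑G G⊑H)

embeds? : ∀ H G f → Dec (Embeds H G f)
embeds? H G f =
  map′ (λ (a , i) → (λ {u v} → i u v) , a)
       (λ (i , a) → a , λ u v → i)
       -- Adjacency is tested first, so that a map failing it is rejected before injectivity is
       -- examined.
       (all? (λ u → all? λ v → adj H u v Bool.≟ adj G (f u) (f v))
        ×-dec all? (λ u → all? λ v → (f u ≟ f v) →-dec (u ≟ v)))

module _ (G : Graph) (p : Vertex G → Bool) where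

  extendAdj : Fin (suc (order G)) → Fin (suc (order G)) → Bool
  extendAdj zero    zero    = false
  extendAdj zero    (suc v) = p v
  extendAdj (suc u) zero    = p u
  extendAdj (suc u) (suc v) = adj G u v

  extend : Graph
  extend = record
    { order  = suc (order G)
    ; adj    = extendAdj
    ; sym    = λ { zero zero → refl ; zero (suc v) → refl
                 ; (suc u) zero → refl ; (suc u) (suc v) → Graph.sym G u v }
    ; irrefl = λ { zero → refl ; (suc v) → Graph.irrefl G v }
    }

extend-⊑ : ∀ H G {p : Vertex H → Bool} (H⊑G : H ⊑ G) (v : Vertex G) →
  (∀ x → proj₁ H⊑G x ≢ v) → (∀ x → p x ≡ adj G v (proj₁ H⊑G x)) →
  extend H p ⊑ G
extend-⊑ H G {p} (f , f-inj , f-adj) v v∉f p≗ = g , g-inj , g-adj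
  where
  g : Fin (suc (order H)) → Vertex G
  g zero    = v
  g (suc x) = f x
  g-inj : Injective _≡_ _≡_ g
  g-inj {zero}  {zero}  eq = refl
  g-inj {zero}  {suc y} eq = contradiction (sym eq) (v∉f y)
  g-inj {suc x} {zero}  eq = contradiction eq (v∉f x)
  g-inj {suc x} {suc y} eq = cong suc (f-inj eq)
  g-adj : ∀ x y → extendAdj H p x y ≡ adj G (g x) (g y)
  g-adj zero    zero    = sym (Graph.irrefl G v)
  g-adj zero    (suc y) = p≗ y
  g-adj (suc x) zero    = trans (p≗ x) (Graph.sym G v (f x))
  g-adj (suc x) (suc y) = f-adj x y

forbidden : List Graph
forbidden = 4 K₁ ∷ C 4 ∷ C 6 ∷ []

-- A prescribed map of a forbidden graph. Testing a short list of these replaces a search through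
-- all maps, and the membership proof lets any occurrence contradict freeness.
Candidate : ℕ → Set
Candidate n = ∃[ H ] H ∈ forbidden × (Vertex H → Fin n)

Occurs : ∀ G → Candidate (order G) → Set
Occurs G (H , _ , f) = Embeds H G f

Obstructed : ∀ G → List (Candidate (order G)) → Set
Obstructed G = Any (Occurs G)

obstructed? : ∀ G cs → Dec (Obstructed G cs)
obstructed? G = Any.any? (λ (H , _ , f) → embeds? H G f)

Free⇒¬Obstructed : ∀ G cs → Free forbidden G → ¬ Obstructed G cs
Free⇒¬Obstructed G cs free obs with Any.satisfied obs
... | (H , H∈ , f) , emb = All.lookup free H∈ (f , emb)

4K₁∈ : 4 K₁ ∈ forbidden
4K₁∈ = here refl
C4∈ : C 4 ∈ forbidden
C4∈ = there (here refl)
C6∈ : C 6 ∈ forbidden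
C6∈ = there (there (here refl))

rotate : Fin 7 → Fin 7 → Fin 7
rotate r i = (toℕ r + toℕ i) mod 7

lift₁ : ∀ {n} → (Fin n → Fin n) → Fin (suc n) → Fin (suc n)
lift₁ f zero    = zero
lift₁ f (suc i) = suc (f i)

rotations : ∀ {n} → ((Fin 7 → Fin 7) → Fin n → Fin n) → List (Candidate n) → List (Candidate n)
rotations lift = List.concatMap λ (H , H∈ , f) →
  List.map (λ r → H , H∈ , lift (rotate r) ∘ f) (List.allFin 7)

-- In an extension the new vertex is 0 and the vertex i of the cycle is suc i;
-- after two extensions it is suc (suc i), and the new vertices are 0 and 1.
-- The candidates, up to rotation of the cycle, come from a computer search.
candidates₁ : List (Candidate 8)
candidates₁ = rotations lift₁
  ( (C 4 , C4∈ , lookup (# 0 ∷ # 1 ∷ # 2 ∷ # 3 ∷ []))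
  ∷ (C 6 , C6∈ , lookup (# 0 ∷ # 1 ∷ # 2 ∷ # 3 ∷ # 4 ∷ # 5 ∷ []))
  ∷ (4 K₁ , 4K₁∈ , lookup (# 0 ∷ # 1 ∷ # 3 ∷ # 5 ∷ []))
  ∷ [])

candidates₂ : List (Candidate 9)
candidates₂ = rotations (λ r → lift₁ (lift₁ r))
  ( (C 4 , C4∈ , lookup (# 0 ∷ # 2 ∷ # 1 ∷ # 5 ∷ []))
  ∷ (C 4 , C4∈ , lookup (# 0 ∷ # 2 ∷ # 1 ∷ # 7 ∷ []))
  ∷ (C 4 , C4∈ , lookup (# 0 ∷ # 2 ∷ # 3 ∷ # 1 ∷ []))
  ∷ (C 4 , C4∈ , lookup (# 0 ∷ # 2 ∷ # 8 ∷ # 1 ∷ []))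
  ∷ (4 K₁ , 4K₁∈ , lookup (# 0 ∷ # 1 ∷ # 2 ∷ # 7 ∷ []))
  ∷ (4 K₁ , 4K₁∈ , lookup (# 0 ∷ # 1 ∷ # 2 ∷ # 5 ∷ []))
  ∷ (C 6 , C6∈ , lookup (# 0 ∷ # 1 ∷ # 2 ∷ # 3 ∷ # 4 ∷ # 5 ∷ []))
  ∷ (C 6 , C6∈ , lookup (# 0 ∷ # 2 ∷ # 8 ∷ # 7 ∷ # 1 ∷ # 5 ∷ []))
  ∷ (C 6 , C6∈ , lookup (# 0 ∷ # 1 ∷ # 2 ∷ # 8 ∷ # 7 ∷ # 6 ∷ []))
  ∷ (C 6 , C6∈ , lookup (# 0 ∷ # 2 ∷ # 3 ∷ # 4 ∷ # 1 ∷ # 6 ∷ []))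
  ∷ (C 6 , C6∈ , lookup (# 0 ∷ # 2 ∷ # 1 ∷ # 5 ∷ # 6 ∷ # 7 ∷ []))
  ∷ (C 6 , C6∈ , lookup (# 0 ∷ # 2 ∷ # 1 ∷ # 6 ∷ # 5 ∷ # 4 ∷ []))
  ∷ [])

ext₁ : Subset 7 → Graph
ext₁ p = extend (C 7) (lookup p)

ext₂ : Subset 7 → Subset 7 → Bool → Graph
ext₂ p q e = extend (ext₁ p) (lookup (e ∷ q))

Admissible₁ : Subset 7 → Set
Admissible₁ p = ¬ Obstructed (ext₁ p) candidates₁

admissible₁? : ∀ p → Dec (Admissible₁ p)
admissible₁? p = ¬? (obstructed? (ext₁ p) candidates₁)

Admissible₂ : Subset 7 → Subset 7 → Bool → Set
Admissible₂ p q e = ¬ Obstructed (ext₂ p q e) candidates₂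

admissible₂? : ∀ p q e → Dec (Admissible₂ p q e)
admissible₂? p q e = ¬? (obstructed? (ext₂ p q e) candidates₂)

-- A vertex off the cycle adjacent to exactly the two neighbours of `i` would form an induced `C 4`
-- with them and `i`.
C7-row-inadmissible : ∀ i → ¬ Admissible₁ (tabulate (adj (C 7) i))
C7-row-inadmissible = toWitness {a? = all? λ i → ¬? (admissible₁? (tabulate (adj (C 7) i)))} tt

C7-rows-differ : ∀ i j → (∀ k → adj (C 7) k i ≡ adj (C 7) k j) → i ≡ j
C7-rows-differ = toWitness
  {a? = all? λ i → all? λ j → (all? λ k → adj (C 7) k i Bool.≟ adj (C 7) k j) →-dec (i ≟ j)} tt

-- Up to rotation: three consecutive vertices, five consecutive vertices, a vertex with its opposite
-- edge; finally the whole cycle.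
admissiblePatterns : List (Subset 7)
admissiblePatterns =
    (List.concatMap (λ r → List.map (λ p → tabulate (λ i → lookup p (rotate r i)))
      ( (inside ∷ inside ∷ inside ∷ outside ∷ outside ∷ outside ∷ outside ∷ [])
      ∷ (inside ∷ inside ∷ inside ∷ inside ∷ inside ∷ outside ∷ outside ∷ [])
      ∷ (inside ∷ outside ∷ outside ∷ inside ∷ inside ∷ outside ∷ outside ∷ [])
      ∷ []))
      (List.allFin 7))
  List.++ (inside ∷ inside ∷ inside ∷ inside ∷ inside ∷ inside ∷ inside ∷ []) ∷ []

_∈?_ : ∀ (p : Subset 7) ps → Dec (p ∈ ps)
p ∈? ps = Any.any? (λ q → ≡-dec Bool._≟_ p q) ps

-- Negated existence is the form that `anySubset?` decides over the 128 patterns; `pattern∈`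
-- recovers the positive form, since membership is decidable.
admissible⇒∈ : ¬ (∃[ p ] Admissible₁ p × ¬ (p ∈ admissiblePatterns))
admissible⇒∈ = toWitnessFalse
  {a? = anySubset? λ p → admissible₁? p ×-dec ¬? (p ∈? admissiblePatterns)} tt

-- Every listed pattern contains two nonadjacent vertices of the cycle; with two nonadjacent
-- vertices of that pattern they would form an induced `C 4`.
same-pattern-adjacent : All (λ p → ¬ Admissible₂ p p false) admissiblePatterns
same-pattern-adjacent = toWitness
  {a? = All.all? (λ p → ¬? (admissible₂? p p false)) admissiblePatterns} tt

-- For each pair of patterns a candidate occurs for one of the two values of the adjacency. So the
-- patterns of two vertices off the cycle fix whether these are adjacent.
adjacency-determined : All (λ p →
  All (λ q → ¬ (Admissible₂ p q false × Admissible₂ p q true)) admissiblePatterns)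
  admissiblePatterns
adjacency-determined = toWitness
  {a? = All.all? (λ p → All.all?
    (λ q → ¬? (admissible₂? p q false ×-dec admissible₂? p q true)) admissiblePatterns)
    admissiblePatterns} tt

SamePattern : ∀ G {m} → (Fin m → Vertex G) → Vertex G → Vertex G → Set
SamePattern G c u v = ∀ i → adj G (c i) u ≡ adj G (c i) v

TrueTwins : ∀ G → Vertex G → Vertex G → Set
TrueTwins G u v =
  adj G u v ≡ true × (∀ w → w ≢ u → w ≢ v → adj G u w ≡ adj G v w)

PatternsDetermine : ∀ G {m} → (Fin m → Vertex G) → Set
PatternsDetermine G c =
  ∀ u v → u ≢ v → SamePattern G c u v → TrueTwins G u v

module _ (G : Graph) (free : Free forbidden G) (C7⊑G : C 7 ⊑ G) where

  private
    f : Fin 7 → Vertex G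
    f = proj₁ C7⊑G
    f-adj = proj₂ (proj₂ C7⊑G)

    pattern-of : Vertex G → Subset 7
    pattern-of v = tabulate λ i → adj G (f i) v

    Outside : Vertex G → Set
    Outside v = ∀ i → f i ≢ v

    position : ∀ v → ∃ (λ i → f i ≡ v) ⊎ Outside v
    position v with any? (λ i → f i ≟ v)
    ... | yes p = inj₁ p
    ... | no ¬p = inj₂ λ i eq → ¬p (i , eq)

    lookup-pattern : ∀ v i → lookup (pattern-of v) i ≡ adj G v (f i)
    lookup-pattern v i = trans (lookup∘tabulate (λ j → adj G (f j) v) i) (Graph.sym G (f i) v)

    ext₁-⊑ : ∀ v → Outside v → ext₁ (pattern-of v) ⊑ G
    ext₁-⊑ v out = extend-⊑ (C 7) G C7⊑G v out (lookup-pattern v)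

    admissible₁ : ∀ v → Outside v → Admissible₁ (pattern-of v)
    admissible₁ v out = Free⇒¬Obstructed H candidates₁ (Free-⊑ H G (ext₁-⊑ v out) free)
      where
      H : Graph
      H = ext₁ (pattern-of v)

    pattern∈ : ∀ v → Outside v → pattern-of v ∈ admissiblePatterns
    pattern∈ v out = decidable-stable (pattern-of v ∈? admissiblePatterns) λ p∉ →
      admissible⇒∈ (pattern-of v , admissible₁ v out , p∉)

    admissible₂ : ∀ u w → Outside u → Outside w → u ≢ w →
      Admissible₂ (pattern-of u) (pattern-of w) (adj G w u)
    admissible₂ u w out-u out-w u≢w =
      Free⇒¬Obstructed H candidates₂ (Free-⊑ H G H⊑G free)
      where
      H : Graph
      H = ext₂ (pattern-of u) (pattern-of w) (adj G w u)
      H⊑G : H ⊑ G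
      H⊑G = extend-⊑ (ext₁ (pattern-of u)) G (ext₁-⊑ u out-u) w
        (λ { zero → u≢w ; (suc i) → out-w i })
        (λ { zero → refl ; (suc i) → lookup-pattern w i })

    C7-pattern-inadmissible : ∀ i v → Outside v → ¬ SamePattern G f (f i) v
    C7-pattern-inadmissible i v out same =
      C7-row-inadmissible i (subst Admissible₁ pattern≡row (admissible₁ v out))
      where
      pattern≡row : pattern-of v ≡ tabulate (adj (C 7) i)
      pattern≡row = tabulate-cong λ j →
        trans (sym (same j)) (trans (sym (f-adj j i)) (Graph.sym (C 7) j i))

  -- Distinct vertices never share a pattern if one of them is on the cycle: rows of `C 7` differ,
  -- and no vertex off the cycle copies a row. Off the cycle the finite checks on pairs of patterns
  -- apply.
  C7-patterns-determine : PatternsDetermine G f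
  C7-patterns-determine u v u≢v same with position u | position v
  ... | inj₁ (i , refl) | inj₁ (j , refl) = contradiction
    (cong f (C7-rows-differ i j λ k → trans (f-adj k i) (trans (same k) (sym (f-adj k j))))) u≢v
  ... | inj₁ (i , refl) | inj₂ out-v = contradiction same (C7-pattern-inadmissible i v out-v)
  ... | inj₂ out-u | inj₁ (j , refl) = contradiction (sym ∘ same) (C7-pattern-inadmissible j u out-u)
  ... | inj₂ out-u | inj₂ out-v = adjacent , same-adj
    where
    same-pattern : pattern-of u ≡ pattern-of v
    same-pattern = tabulate-cong same

    adjacent : adj G u v ≡ true
    adjacent with adj G u v in eq
    ... | true  = refl
    ... | false = contradiction
      (subst₂ (λ q e → Admissible₂ (pattern-of v) q e) same-pattern eq
        (admissible₂ v u out-v out-u (u≢v ∘ sym)))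
      (All.lookup same-pattern-adjacent (pattern∈ v out-v))

    determined : ∀ w → Outside w → ∀ {a b} → a ≢ b →
      Admissible₂ (pattern-of w) (pattern-of u) a → Admissible₂ (pattern-of w) (pattern-of u) b →
      ∀ {A : Set} → A
    determined w out {false} {false} a≢b _ _ = contradiction refl a≢b
    determined w out {true}  {true}  a≢b _ _ = contradiction refl a≢b
    determined w out {false} {true}  _ g g′ = contradiction (g , g′)
      (All.lookup (All.lookup adjacency-determined (pattern∈ w out)) (pattern∈ u out-u))
    determined w out {true}  {false} _ g g′ = contradiction (g′ , g)
      (All.lookup (All.lookup adjacency-determined (pattern∈ w out)) (pattern∈ u out-u))

    same-adj : ∀ w → w ≢ u → w ≢ v → adj G u w ≡ adj G v w
    same-adj w w≢u w≢v with position w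
    ... | inj₁ (i , refl) = trans (Graph.sym G u (f i)) (trans (same i) (Graph.sym G (f i) v))
    -- If `u` and `v` differed at `w`, both adjacency values would be admissible for one and the
    -- same pair of patterns.
    ... | inj₂ out-w = decidable-stable (_ Bool.≟ _) λ ne →
      determined w out-w ne (admissible₂ w u out-w out-u w≢u)
        (subst (λ q → Admissible₂ (pattern-of w) q (adj G v w)) (sym same-pattern)
          (admissible₂ w v out-w out-v w≢v))

-- Arithmetic terms and their compilation

-- Only `∑ᵗ` loops, with the order of the graph as its bound, so the nesting of sums governs the
-- degree of the running time. Truncated subtraction supplies negation and comparison.
data Term : ℕ → Set where
  var     : ∀ {d} → Fin d → Term d
  lit     : ∀ {d} → ℕ → Term d
  _⊞_ _⊟_ : ∀ {d} → Term d → Term d → Term d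
  at      : ∀ {d} → Term d → Term d
  ∑ᵗ      : ∀ {d} → Term (suc d) → Term d

infixl 6 _⊞_ _⊟_

-- The last summand is added last, in the order in which the compiled loop accumulates.
sumTo : ℕ → (ℕ → ℕ) → ℕ
sumTo zero    f = 0
sumTo (suc n) f = sumTo n f + f n

eval : ∀ {d} → Term d → (ℕ → ℕ) → Vec ℕ d → ℕ
eval (var i)   M ρ = lookup ρ i
eval (lit k)   M ρ = k
eval (e ⊞ e′)  M ρ = eval e M ρ + eval e′ M ρ
eval (e ⊟ e′)  M ρ = eval e M ρ ∸ eval e′ M ρ
eval (at e)    M ρ = M (eval e M ρ)
eval (∑ᵗ e)    M ρ = sumTo (M 0) λ i → eval e M (i ∷ ρ)

-- The value goes to variable b, using b, b + 1, … as a stack; the variables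
-- of the term live at the locations ls below b.
compile : ∀ {d} → Term d → Vec ℕ d → ℕ → Program
compile (var i)  ls b = b ≔ var (lookup ls i)
compile (lit k)  ls b = b ≔ lit k
compile (e ⊞ e′) ls b = compile e ls b ⨾ compile e′ ls (1 + b) ⨾ b ≔ var b ⊕ var (1 + b)
compile (e ⊟ e′) ls b = compile e ls b ⨾ compile e′ ls (1 + b) ⨾ b ≔ var b ⊖ var (1 + b)
compile (at e)   ls b = compile e ls b ⨾ b ≔ mem[ var b ]
compile (∑ᵗ e)   ls b =
  b ≔ lit 0 ⨾
  1 + b ≔ lit 0 ⨾
  WHILE mem[ lit 0 ] ⊖ var (1 + b) DO
    (compile e (1 + b ∷ ls) (2 + b) ⨾
     b ≔ var b ⊕ var (2 + b) ⨾
     1 + b ≔ var (1 + b) ⊕ lit 1)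

-- The constants are costs of the commands in `compile`: in a sum, 2 and 2 for the initialisations,
-- 5 for each test, 8 for the two updates closing the body, and a last 5 for the test that fails.
time : ∀ {d} → Term d → ℕ → ℕ
time (var i)  n = 2
time (lit k)  n = 2
time (e ⊞ e′) n = time e n + (time e′ n + 4)
time (e ⊟ e′) n = time e n + (time e′ n + 4)
time (at e)   n = time e n + 3
time (∑ᵗ e)   n = 2 + (2 + (n * (5 + (time e n + 8)) + 5))

-- Correctness and running time of compiled terms

update-same : ∀ f a v → (f [ a ↦ v ]) a ≡ v
update-same f a v with a ≡ᵇ a in eq
... | true  = refl
... | false with () ← subst T eq (≡⇒≡ᵇ a a refl)

update-other : ∀ f {a} v {b} → a ≢ b → (f [ a ↦ v ]) b ≡ f b
update-other f {a} v {b} a≢b with a ≡ᵇ b in eq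
... | false = refl
... | true  = contradiction (≡ᵇ⇒≡ a b (subst T (sym eq) tt)) a≢b

-- A total-correctness Hoare triple with a time bound, for one initial store; `_then_` is its rule
-- for sequencing.
Runs : Program → Store → ℕ → (Store → Set) → Set
Runs p s T Q = ∃[ t ] ∃[ s′ ] (⟨ p , s ⟩⇓[ t ] s′) × t ≤ T × Q s′

_then_ : ∀ {p q s T T′ Q Q′} → Runs p s T Q → (∀ {s′} → Q s′ → Runs q s′ T′ Q′) →
  Runs (p ⨾ q) s (T + T′) Q′
(t , s′ , p⇓ , t≤ , q) then k with k q
... | t′ , s″ , q⇓ , t′≤ , q′ = t + t′ , s″ , ⇓seq p⇓ q⇓ , +-mono-≤ t≤ t′≤ , q′

infixl 1 _then_

runs-≤ : ∀ {p s T T′ Q} → T ≤ T′ → Runs p s T Q → Runs p s T′ Q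
runs-≤ T≤T′ (t , s′ , p⇓ , t≤ , q) = t , s′ , p⇓ , ≤-trans t≤ T≤T′ , q

module _ (M : ℕ → ℕ) where

  -- `below` is the frame condition of the stack discipline: it preserves bound variables and
  -- operands already computed.
  record Result (s : Store) (b v : ℕ) (s′ : Store) : Set where
    constructor result
    field
      value  : vars s′ b ≡ v
      below  : ∀ x → x < b → vars s′ x ≡ vars s x
      memory : mem s′ ≡ M
  open Result

  Located : ∀ {d} → Vec ℕ d → Vec ℕ d → ℕ → Store → Set
  Located ls ρ b s = ∀ i → lookup ls i < b × vars s (lookup ls i) ≡ lookup ρ i

  located-step : ∀ {d} (ls ρ : Vec ℕ d) {b b′ s s′} → b ≤ b′ →
    (∀ x → x < b → vars s′ x ≡ vars s x) → Located ls ρ b s → Located ls ρ b′ s′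
  located-step ls ρ b≤b′ below loc i with loc i
  ... | l<b , eq = <-≤-trans l<b b≤b′ , trans (below _ l<b) eq

  runs-≔ : ∀ {s₀ s b e v} → (∀ x → x < b → vars s x ≡ vars s₀ x) → ⟦ e ⟧ s ≡ v → mem s ≡ M →
    Runs (b ≔ e) s (1 + cost e) (Result s₀ b v)
  runs-≔ {s = s} {b} below v≡ m = _ , _ , ⇓var , ≤-refl ,
    result (trans (update-same (vars s) b _) v≡)
      (λ x x<b → trans (update-other (vars s) _ (>⇒≢ x<b)) (below x x<b)) m

  -- The left operand stays in `b` while the right one is computed, because the latter works from
  -- `1 + b` upwards.
  runs-binary : ∀ {p q s b v v′ T T′} (_∙_ : Expr → Expr → Expr) (_∘_ : ℕ → ℕ → ℕ) →
    (∀ e e′ s → ⟦ e ∙ e′ ⟧ s ≡ ⟦ e ⟧ s ∘ ⟦ e′ ⟧ s) →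
    (∀ e e′ → cost (e ∙ e′) ≡ 1 + cost e + cost e′) →
    Runs p s T (Result s b v) →
    (∀ {s′} → Result s b v s′ → Runs q s′ T′ (Result s′ (1 + b) v′)) →
    Runs (p ⨾ q ⨾ b ≔ var b ∙ var (1 + b)) s (T + (T′ + 4)) (Result s b (v ∘ v′))
  runs-binary {b = b} _∙_ _∘_ ⟦∙⟧ cost-∙ p-runs q-runs = p-runs then λ r →
    q-runs r then λ r′ →
    runs-≤ (s≤s (≤-reflexive (cost-∙ _ _)))
      (runs-≔ (λ x x<b → trans (below r′ x (m<n⇒m<1+n x<b)) (below r x x<b))
              (trans (⟦∙⟧ _ _ _) (cong₂ _∘_ (trans (below r′ b (n<1+n b)) (value r)) (value r′)))
              (memory r′))

  compile-runs : ∀ {d} (e : Term d) {ls ρ b s} → Located ls ρ b s → mem s ≡ M →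
    Runs (compile e ls b) s (time e (M 0)) (Result s b (eval e M ρ))
  compile-runs (var i)  loc m = runs-≔ (λ _ _ → refl) (proj₂ (loc i)) m
  compile-runs (lit k)  loc m = runs-≔ (λ _ _ → refl) refl m
  compile-runs (e ⊞ e′) {ls} {ρ} {b} {s} loc m =
    runs-binary _⊕_ _+_ (λ _ _ _ → refl) (λ _ _ → refl) (compile-runs e loc m) λ {s′} r →
      compile-runs e′ (located-step ls ρ {s = s} {s′} (n≤1+n b) (below r) loc) (memory r)
  compile-runs (e ⊟ e′) {ls} {ρ} {b} {s} loc m =
    runs-binary _⊖_ _∸_ (λ _ _ _ → refl) (λ _ _ → refl) (compile-runs e loc m) λ {s′} r →
      compile-runs e′ (located-step ls ρ {s = s} {s′} (n≤1+n b) (below r) loc) (memory r)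
  compile-runs (at e)   loc m = compile-runs e loc m then λ r →
    runs-≔ (below r) (cong₂ (λ f x → f x) (memory r) (value r)) (memory r)
  compile-runs (∑ᵗ e) {ls} {ρ} {b} {s} loc m =
    runs-≔ {s} (λ _ _ → refl) refl m then λ {s₁} r →
    runs-≔ {s₁} (λ _ _ → refl) refl (memory r) then λ r′ →
    loop (M 0) 0 refl (invariant
      (trans (below r′ b (n<1+n b)) (value r))
      (value r′)
      (λ y y<b → trans (below r′ y (m<n⇒m<1+n y<b)) (below r y y<b))
      (memory r′))
    where
    f : ℕ → ℕ
    f i = eval e M (i ∷ ρ)

    record Invariant (x : ℕ) (s′ : Store) : Set where
      constructor invariant
      field
        total   : vars s′ b ≡ sumTo x f
        counter : vars s′ (1 + b) ≡ x
        rest    : ∀ y → y < b → vars s′ y ≡ vars s y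
        memory′ : mem s′ ≡ M
    open Invariant

    body = compile e (1 + b ∷ ls) (2 + b) ⨾
           b ≔ var b ⊕ var (2 + b) ⨾
           1 + b ≔ var (1 + b) ⊕ lit 1

    body-runs : ∀ {x s′} → Invariant x s′ → Runs body s′ (time e (M 0) + 8) (Invariant (suc x))
    body-runs {x} {s′} inv = compile-runs e located (memory′ inv) then λ r →
      _ , _ , ⇓seq ⇓var ⇓var , ≤-refl , step r
      where
      step : ∀ {s₁} → Result s′ (2 + b) (f x) s₁ →
        let vs = vars s₁ [ b ↦ vars s₁ b + vars s₁ (2 + b) ] in
        Invariant (suc x) (store (vs [ 1 + b ↦ vs (1 + b) + 1 ]) (mem s₁))
      step {s₁} r = invariant
        (trans (update-other vs _ (1+n≢n {b}))
          (trans (update-same (vars s₁) b _)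
            (cong₂ _+_ (trans (below r b (m<n⇒m<1+n (n<1+n b))) (total inv)) (value r))))
        (trans (update-same vs (1 + b) _)
          (trans (cong (_+ 1) (trans (update-other (vars s₁) _ (1+n≢n {b} ∘ sym))
            (trans (below r (1 + b) (n<1+n _)) (counter inv)))) (+-comm x 1)))
        (λ y y<b → trans (update-other vs _ (>⇒≢ (m<n⇒m<1+n y<b)))
          (trans (update-other (vars s₁) _ (>⇒≢ y<b))
            (trans (below r y (m<n⇒m<1+n (m<n⇒m<1+n y<b))) (rest inv y y<b))))
        (memory r)
        where vs = vars s₁ [ b ↦ vars s₁ b + vars s₁ (2 + b) ]
      located : Located (1 + b ∷ ls) (x ∷ ρ) (2 + b) s′
      located zero    = n<1+n _ , counter inv
      located (suc i) = located-step ls ρ {s = s} {s′} (≤-trans (n≤1+n b) (n≤1+n _)) (rest inv) loc i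

    -- Induction on the number `r` of iterations left. By `x + r ≡ M 0` the test evaluates to `r`,
    -- so it fails exactly at the end.
    loop : ∀ r x {s′} → x + r ≡ M 0 → Invariant x s′ →
      Runs (WHILE mem[ lit 0 ] ⊖ var (1 + b) DO body) s′ (r * (5 + (time e (M 0) + 8)) + 5)
        (Result s b (sumTo (M 0) f))
    loop zero x {s′} x+0≡ inv = _ , _ , ⇓stop test , ≤-refl ,
      result (trans (total inv) (cong (λ n → sumTo n f) (trans (sym (+-identityʳ x)) x+0≡)))
        (rest inv) (memory′ inv)
      where
      test : mem s′ 0 ∸ vars s′ (1 + b) ≡ 0
      test rewrite memory′ inv | counter inv | sym x+0≡ | +-identityʳ x = n∸n≡0 x
    loop (suc r) x {s′} x+r≡ inv with body-runs inv
    ... | t , s″ , body⇓ , t≤ , inv′ with loop r (suc x) (trans (sym (+-suc x r)) x+r≡) inv′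
    ... | u , s‴ , loop⇓ , u≤ , res = _ , s‴ , ⇓loop test body⇓ loop⇓ ,
      ≤-trans (+-mono-≤ (+-monoʳ-≤ 5 t≤) u≤)
        (≤-reflexive (sym (+-assoc (5 + (time e (M 0) + 8)) _ 5))) , res
      where
      test : mem s′ 0 ∸ vars s′ (1 + b) ≢ 0
      test rewrite memory′ inv | counter inv | sym x+r≡ | m+n∸m≡n x (suc r) = λ ()

-- Polynomial bounds for running times

module _ where

  open ≤-Reasoning

  -- Bounds are kept in powers of `suc n`, which are positive and so absorb constants even for
  -- `n = 0`.
  constant-≤ : ∀ c n k → c ≤ c * suc n ^ k
  constant-≤ c n k = m≤m*n c (suc n ^ k) {{m^n≢0 (suc n) k}}

  binary-polynomial : ∀ {f g : ℕ → ℕ} →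
    ∃[ c ] ∃[ k ] (∀ n → f n ≤ c * suc n ^ k) →
    ∃[ c ] ∃[ k ] (∀ n → g n ≤ c * suc n ^ k) →
    ∃[ c ] ∃[ k ] (∀ n → f n + (g n + 4) ≤ c * suc n ^ k)
  binary-polynomial {f} {g} (c , k , f≤) (c′ , k′ , g≤) = c + (c′ + 4) , k + k′ , λ n →
    let N = suc n ^ (k + k′) in begin
    f n + (g n + 4)
      ≤⟨ +-mono-≤ (f≤ n) (+-mono-≤ (g≤ n) (constant-≤ 4 n (k + k′))) ⟩
    c * suc n ^ k + (c′ * suc n ^ k′ + 4 * N)
      ≤⟨ +-mono-≤ (*-monoʳ-≤ c (^-monoʳ-≤ (suc n) (m≤m+n k k′)))
           (+-monoˡ-≤ (4 * N) (*-monoʳ-≤ c′ (^-monoʳ-≤ (suc n) (m≤n+m k′ k)))) ⟩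
    c * N + (c′ * N + 4 * N)
      ≡⟨ solve 3 (λ c c′ N → c :* N :+ (c′ :* N :+ con 4 :* N) := (c :+ (c′ :+ con 4)) :* N)
           refl c c′ N ⟩
    (c + (c′ + 4)) * N  ∎

  polynomial-time : ∀ {d} (e : Term d) → ∃[ c ] ∃[ k ] (∀ n → time e n ≤ c * suc n ^ k)
  polynomial-time (var i) = 2 , 0 , λ n → ≤-refl
  polynomial-time (lit k) = 2 , 0 , λ n → ≤-refl
  polynomial-time (e ⊞ e′) = binary-polynomial (polynomial-time e) (polynomial-time e′)
  polynomial-time (e ⊟ e′) = binary-polynomial (polynomial-time e) (polynomial-time e′)
  polynomial-time (at e) with polynomial-time e
  ... | c , k , t≤ = c + 3 , k , λ n → begin
    time e n + 3                          ≤⟨ +-mono-≤ (t≤ n) (constant-≤ 3 n k) ⟩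
    c * suc n ^ k + 3 * suc n ^ k         ≡⟨ *-distribʳ-+ (suc n ^ k) c 3 ⟨
    (c + 3) * suc n ^ k                   ∎
  polynomial-time (∑ᵗ e) with polynomial-time e
  -- 22 is 13 + 9: 13 = 5 + 8 is the overhead of an iteration, 9 = 4 + 5 that of the initialisation
  -- and the failing test.
  ... | c , k , t≤ = c + 22 , suc k , λ n → begin
    4 + (n * (5 + (time e n + 8)) + 5)
      ≡⟨ solve 2 (λ n t → con 4 :+ (n :* (con 5 :+ (t :+ con 8)) :+ con 5)
                       := n :* t :+ (n :* con 13 :+ con 9)) refl n (time e n) ⟩
    n * time e n + (n * 13 + 9)
      ≤⟨ +-mono-≤ (*-mono-≤ (n≤1+n n) (t≤ n))
           (+-mono-≤ (*-monoˡ-≤ 13 (n≤1+n n)) (m≤m*n 9 (suc n))) ⟩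
    suc n * (c * suc n ^ k) + (suc n * 13 + 9 * suc n)
      ≡⟨ solve 3 (λ N c p → N :* (c :* p) :+ (N :* con 13 :+ con 9 :* N)
                         := c :* (N :* p) :+ con 22 :* N) refl (suc n) c (suc n ^ k) ⟩
    c * suc n ^ suc k + 22 * suc n
      ≤⟨ +-monoʳ-≤ (c * suc n ^ suc k)
           (*-monoʳ-≤ 22 (m≤m*n (suc n) (suc n ^ k) {{m^n≢0 (suc n) k}})) ⟩
    c * suc n ^ suc k + 22 * suc n ^ suc k
      ≡⟨ *-distribʳ-+ (suc n ^ suc k) c 22 ⟨
    (c + 22) * suc n ^ suc k  ∎

  ^-distrib-* : ∀ m n k → (m * n) ^ k ≡ m ^ k * n ^ k
  ^-distrib-* m n zero    = refl
  ^-distrib-* m n (suc k) rewrite ^-distrib-* m n k =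
    solve 4 (λ m n p q → m :* n :* (p :* q) := m :* p :* (n :* q)) refl m n (m ^ k) (n ^ k)

  -- Returns from base `suc n` to base `n`: for positive `n` the base at most doubles, and the
  -- summand 1 covers `n = 0`.
  suc-^-≤ : ∀ n k → suc n ^ k ≤ 2 ^ k * n ^ k + 1
  suc-^-≤ zero    k rewrite ^-zeroˡ k = m≤n+m 1 (2 ^ k * 0 ^ k)
  suc-^-≤ (suc n) k = begin
    suc (suc n) ^ k             ≤⟨ ^-monoˡ-≤ k (begin
      2 + n                       ≤⟨ m≤m+n (2 + n) n ⟩
      2 + n + n                   ≡⟨ solve 1 (λ n → con 2 :+ n :+ n := con 2 :* (con 1 :+ n)) refl n ⟩
      2 * suc n                   ∎) ⟩
    (2 * suc n) ^ k             ≡⟨ ^-distrib-* 2 (suc n) k ⟩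
    2 ^ k * suc n ^ k           ≤⟨ m≤m+n _ 1 ⟩
    2 ^ k * suc n ^ k + 1       ∎

  -- With stack base 0 the value ends in variable 0, where `output` reads it. The witness
  -- `c * 2 ^ k + c` has to serve both as factor and as additive constant.
  term-solvable : ∀ {IsAnswer Class} (e : Term 0) →
    (∀ G → Class G → IsAnswer G (eval e (load (encode G)) [])) →
    SolvableInPolynomialTime IsAnswer Class
  term-solvable {IsAnswer} e correct with polynomial-time e
  ... | c , k , t≤ = compile e [] 0 , c * 2 ^ k + c , k , λ G G∈ →
    let t , s , e⇓ , t≤′ , res = compile-runs (load (encode G)) e {s = initial G} (λ ()) refl
        n = order G
    in t , s , e⇓ , (begin
         t                                  ≤⟨ t≤′ ⟩
         time e n                           ≤⟨ t≤ n ⟩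
         c * suc n ^ k                      ≤⟨ *-monoʳ-≤ c (suc-^-≤ n k) ⟩
         c * (2 ^ k * n ^ k + 1)            ≡⟨ solve 3 (λ c p q →
                                                 c :* (p :* q :+ con 1) := c :* p :* q :+ c)
                                                 refl c (2 ^ k) (n ^ k) ⟩
         c * 2 ^ k * n ^ k + c              ≤⟨ +-mono-≤ (*-monoˡ-≤ (n ^ k) (m≤m+n (c * 2 ^ k) c)) (m≤n+m c _) ⟩
         (c * 2 ^ k + c) * n ^ k + (c * 2 ^ k + c) ∎)
       , subst (IsAnswer G) (sym (Result.value res)) (correct G G∈)

-- Counting

𝟙 : Bool → ℕ
𝟙 b = if b then 1 else 0

count : ∀ {n} → (Fin n → Bool) → ℕ
count a = sum (𝟙 ∘ a)

-- A bijection between `Fin k` and the set described by `a`, which avoids forming a subtype.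
record Enumeration {n} (a : Fin n → Bool) (k : ℕ) : Set where
  field
    element   : Fin k → Fin n
    injective : ∀ {i j} → element i ≡ element j → i ≡ j
    sound     : ∀ i → a (element i) ≡ true
    rank      : ∀ v → a v ≡ true → Fin k
    element-rank : ∀ v av → element (rank v av) ≡ v

enumerate : ∀ {n} (a : Fin n → Bool) → Enumeration a (count a)
enumerate {zero}  a = record
  { element = id ; injective = id ; sound = λ () ; rank = λ v _ → v ; element-rank = λ () }
enumerate {suc n} a with a zero in a₀ | enumerate (a ∘ suc)
... | true | e = record
  { element   = λ { zero → zero ; (suc i) → suc (element i) }
  ; injective = λ { {zero} {zero} _ → refl
                  ; {suc i} {suc j} eq → cong suc (injective (suc-injective eq)) }
  ; sound     = λ { zero → a₀ ; (suc i) → sound i }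
  ; rank      = λ { zero _ → zero ; (suc v) av → suc (rank v av) }
  ; element-rank = λ { zero _ → refl ; (suc v) av → cong suc (element-rank v av) }
  } where open Enumeration e
... | false | e = record
  { element   = suc ∘ element
  ; injective = injective ∘ suc-injective
  ; sound     = sound
  ; rank      = λ { zero av → contradiction (trans (sym a₀) av) λ () ; (suc v) av → rank v av }
  ; element-rank = λ { zero av → contradiction (trans (sym a₀) av) λ ()
                     ; (suc v) av → cong suc (element-rank v av) }
  } where open Enumeration e

module _ {m n} (a : Fin m → Bool) (b : Fin n → Bool) where

  private
    module A = Enumeration (enumerate a)
    module B = Enumeration (enumerate b)

  count-injection : (f : Fin m → Fin n) → (∀ v → a v ≡ true → b (f v) ≡ true) →
    (∀ {u v} → a u ≡ true → a v ≡ true → f u ≡ f v → u ≡ v) → count a ≤ count b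
  count-injection f f-maps f-inj = injective⇒≤ {f = g} λ {i} {j} eq →
    A.injective (f-inj (A.sound i) (A.sound j)
      (trans (sym (B.element-rank _ _)) (trans (cong B.element eq) (B.element-rank _ _))))
    where
    g : Fin (count a) → Fin (count b)
    g i = B.rank (f (A.element i)) (f-maps _ (A.sound i))

  module _ (a≤b : count a ≤ count b) where

    -- Converse to `count-injection`: the inequality of counts yields an injection, by matching
    -- ranks.
    match : ∀ v → a v ≡ true → Fin n
    match v av = B.element (inject≤ (A.rank v av) a≤b)

    match-sound : ∀ v av → b (match v av) ≡ true
    match-sound v av = B.sound _

    match-injective : ∀ {u v} au av → match u au ≡ match v av → u ≡ v
    match-injective au av eq =
      trans (sym (A.element-rank _ au))
        (trans (cong A.element (inject≤-injective a≤b a≤b _ _ (B.injective eq))) (A.element-rank _ av))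

sum-split : ∀ m {n} (f : Fin (m + n) → ℕ) → sum f ≡ sum (f ∘ (_↑ˡ n)) + sum (f ∘ (m ↑ʳ_))
sum-split zero    f = refl
sum-split (suc m) f = trans (cong (f zero +_) (sum-split m (f ∘ suc))) (sym (+-assoc (f zero) _ _))

sum-constant : ∀ n x → sum {n} (λ _ → x) ≡ n * x
sum-constant zero    x = refl
sum-constant (suc n) x = cong (x +_) (sum-constant n x)

sum-indicator : ∀ {n} (j : Fin n) (g : Fin n → ℕ) → sum (λ i → 𝟙 (does (j ≟ i)) * g i) ≡ g j
sum-indicator {suc n} zero    g rewrite sum-constant n 0 | *-zeroʳ n = trans (+-identityʳ _) (+-identityʳ _)
sum-indicator (suc j) g = sum-indicator j (g ∘ suc)

-- A sequence in which every i < n occurs x i times.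
spread : ∀ {n} (x : Fin n → ℕ) → Fin (sum x) → Fin n
spread {suc n} x p = [ (λ _ → zero) , suc ∘ spread (x ∘ suc) ]′ (splitAt (x zero) p)

sum-spread : ∀ {n} (x g : Fin n → ℕ) → sum (g ∘ spread x) ≡ sum (λ i → x i * g i)
sum-spread {zero}  x g = refl
sum-spread {suc n} x g = trans (sum-split (x zero) (g ∘ spread x)) (cong₂ _+_
  (trans (sum-cong-≗ λ i → cong (g ∘ place) (splitAt-↑ˡ (x zero) i _)) (sum-constant (x zero) (g zero)))
  (trans (sum-cong-≗ λ i → cong (g ∘ place) (splitAt-↑ʳ (x zero) _ i)) (sum-spread (x ∘ suc) (g ∘ suc))))
  where
  place = [ (λ (_ : Fin (x zero)) → zero) , suc ∘ spread (x ∘ suc) ]′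

spread-occurs : ∀ {n} (x : Fin n → ℕ) p → x (spread x p) ≢ 0
spread-occurs {suc n} x p with splitAt (x zero) p
... | inj₂ q = spread-occurs (x ∘ suc) q
... | inj₁ q with x zero
... | suc _ = λ ()

fibre : ∀ {k n} → (Fin k → Fin n) → Fin n → ℕ
fibre f i = count (λ c → does (f c ≟ i))

-- Double counting of the pairs of a position and its value. It does for a given sequence what
-- `sum-spread` does for given multiplicities.
sum-fibre : ∀ {k n} (f : Fin k → Fin n) (g : Fin n → ℕ) →
  sum (λ i → fibre f i * g i) ≡ sum (g ∘ f)
sum-fibre f g =
  trans (sum-cong-≗ λ i → *-distribʳ-sum (g i) (λ c → 𝟙 (does (f c ≟ i))))
  (trans (∑-comm λ i c → 𝟙 (does (f c ≟ i)) * g i)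
  (sum-cong-≗ λ c → sum-indicator (f c) g))

sum-≢0 : ∀ {n} (f : Fin n → ℕ) → sum f ≢ 0 → ∃[ i ] f i ≢ 0
sum-≢0 {zero}  f s≢0 = contradiction refl s≢0
sum-≢0 {suc n} f s≢0 with f zero in eq
... | suc _ = zero , λ f₀≡0 → contradiction (trans (sym eq) f₀≡0) λ ()
... | zero  with sum-≢0 (f ∘ suc) s≢0
...   | i , fi≢0 = suc i , fi≢0

sum≡0⇒ : ∀ {n} (f : Fin n → ℕ) → sum f ≡ 0 → ∀ i → f i ≡ 0
sum≡0⇒ f s≡0 zero    = m+n≡0⇒m≡0 (f zero) s≡0
sum≡0⇒ f s≡0 (suc i) = sum≡0⇒ (f ∘ suc) (m+n≡0⇒n≡0 (f zero) s≡0) i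

⇒sum≡0 : ∀ {n} (f : Fin n → ℕ) → (∀ i → f i ≡ 0) → sum f ≡ 0
⇒sum≡0 {zero}  f f≡0 = refl
⇒sum≡0 {suc n} f f≡0 = cong₂ _+_ (f≡0 zero) (⇒sum≡0 (f ∘ suc) (f≡0 ∘ suc))

-- Sums over initial segments, memory layout, least numbers

sumTo-cons : ∀ n f → sumTo (suc n) f ≡ f 0 + sumTo n (f ∘ suc)
sumTo-cons zero    f = sym (+-identityʳ (f 0))
sumTo-cons (suc n) f = trans (cong (_+ f (suc n)) (sumTo-cons n f)) (+-assoc (f 0) _ _)

sumTo-sum : ∀ n f → sumTo n f ≡ sum {n} (f ∘ toℕ)
sumTo-sum zero    f = refl
sumTo-sum (suc n) f = trans (sumTo-cons n f) (cong (f 0 +_) (sumTo-sum n (f ∘ suc)))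

load-++ˡ : ∀ xs {ys a} → a < List.length xs → load (xs List.++ ys) a ≡ load xs a
load-++ˡ (x ∷ xs) {a = zero}  _       = refl
load-++ˡ (x ∷ xs) {a = suc a} (s≤s l) = load-++ˡ xs l

load-++ʳ : ∀ xs {ys} a → load (xs List.++ ys) (List.length xs + a) ≡ load ys a
load-++ʳ []       a = refl
load-++ʳ (x ∷ xs) a = load-++ʳ xs a

load-tabulate : ∀ {n} (h : Fin n → ℕ) v → load (List.tabulate h) (toℕ v) ≡ h v
load-tabulate h zero    = refl
load-tabulate h (suc v) = load-tabulate (h ∘ suc) v

-- The rows are indexed through an arbitrary `h`, so that the induction on `u` can drop the first
-- row, of length `n`.
load-product : ∀ {A : Set} {m n} (g : A → Fin n → ℕ) (h : Fin m → A) u v →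
  load (cartesianProductWith g (List.tabulate h) (List.allFin n)) (toℕ u * n + toℕ v) ≡ g (h u) v
load-product {n = n} g h zero v = begin
  load (row List.++ _) (toℕ v)
    ≡⟨ load-++ˡ row (subst (toℕ v <_) (sym length-row) (toℕ<n v)) ⟩
  load row (toℕ v)
    ≡⟨ cong (λ xs → load xs (toℕ v)) (map-tabulate id (g (h zero))) ⟩
  load (List.tabulate (g (h zero))) (toℕ v)
    ≡⟨ load-tabulate (g (h zero)) v ⟩
  g (h zero) v  ∎
  where
  open ≡-Reasoning
  row = List.map (g (h zero)) (List.allFin n)
  length-row : List.length row ≡ n
  length-row = trans (length-map _ (List.allFin n)) (length-tabulate id)
load-product {n = n} g h (suc u) v = begin
  load (row List.++ rest) (n + toℕ u * n + toℕ v)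
    ≡⟨ cong (load (row List.++ rest))
         (trans (+-assoc n _ _) (cong (_+ (toℕ u * n + toℕ v)) (sym length-row))) ⟩
  load (row List.++ rest) (List.length row + (toℕ u * n + toℕ v))
    ≡⟨ load-++ʳ row _ ⟩
  load rest (toℕ u * n + toℕ v)
    ≡⟨ load-product g (h ∘ suc) u v ⟩
  g (h (suc u)) v  ∎
  where
  open ≡-Reasoning
  row = List.map (g (h zero)) (List.allFin n)
  rest = cartesianProductWith g (List.tabulate (h ∘ suc)) (List.allFin n)
  length-row : List.length row ≡ n
  length-row = trans (length-map _ (List.allFin n)) (length-tabulate id)

module _ (P : ℕ → Set) (P-up : ∀ {i j} → i ≤ j → P i → P j) (f : ℕ → ℕ) where

  private
    Least : ℕ → Set
    Least i = P i × (∀ j → P j → i ≤ j)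

    search : ∀ n → (∀ k → k < n → (P k × f k ≡ 0) ⊎ (¬ P k × f k ≡ 1)) →
      (P n → Least (sumTo n f)) × (¬ P n → sumTo n f ≡ n)
    search zero    dec = (λ P0 → P0 , λ _ _ → z≤n) , λ _ → refl
    search (suc n) dec with dec n (n<1+n n) | search n (λ k k<n → dec k (m<n⇒m<1+n k<n))
    ... | inj₁ (Pn , fn≡0)  | least , _ =
      (λ _ → subst Least (sym (trans (cong (sumTo n f +_) fn≡0) (+-identityʳ _))) (least Pn)) ,
      λ ¬P → contradiction (P-up (n≤1+n n) Pn) ¬P
    ... | inj₂ (¬Pn , fn≡1) | _ , all =
      (λ P1+n → subst Least (sym total) (P1+n , λ j Pj → ≰⇒> λ j≤n → ¬Pn (P-up j≤n Pj))) ,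
      λ _ → total
      where
      total : sumTo n f + f n ≡ suc n
      total = trans (cong₂ _+_ (all ¬Pn) fn≡1) (+-comm n 1)

  -- As `P` is closed upwards, it fails on an initial segment, whose length is the least number with
  -- `P`. Since `P n` holds, counting the failures below `n` suffices.
  least-natural : ∀ n → (∀ k → k < n → (P k × f k ≡ 0) ⊎ (¬ P k × f k ≡ 1)) → P n →
    P (sumTo n f) × (∀ j → P j → sumTo n f ≤ j)
  least-natural n dec = proj₁ (search n dec)

-- Colourings as counts of colours

funToFin-cong : ∀ {m n} {f g : Fin m → Fin n} → f ≗ g → funToFin f ≡ funToFin g
funToFin-cong {zero}  f≗g = refl
funToFin-cong {suc m} f≗g = cong₂ combine (f≗g zero) (funToFin-cong (f≗g ∘ suc))

-- Subsets become numbers, so patterns, and sets of patterns in turn, range over a `Fin` and can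
-- index sums.
encodeBits : ∀ {m} → (Fin m → Bool) → Fin (2 ^ m)
encodeBits f = funToFin (Inverse.from 2↔Bool ∘ f)

bit : ∀ {m} → Fin (2 ^ m) → Fin m → Bool
bit t i = Inverse.to 2↔Bool (finToFun t i)

bit-encodeBits : ∀ {m} (f : Fin m → Bool) → bit (encodeBits f) ≗ f
bit-encodeBits f i = trans
  (cong (Inverse.to 2↔Bool) (finToFun-funToFin (Inverse.from 2↔Bool ∘ f) i))
  (Inverse.inverseˡ 2↔Bool refl)

encodeBits-bit : ∀ {m} {f : Fin m → Bool} t → f ≗ bit t → encodeBits f ≡ t
encodeBits-bit {m} t f≗ = trans
  (funToFin-cong λ i → Inverse.inverseʳ 2↔Bool (f≗ i))
  (funToFin-finToFin {m} {2} t)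

does⇒ : ∀ {A : Set} (d : Dec A) → does d ≡ true → A
does⇒ (yes a) refl = a

summand-≤ : ∀ {n} (x : Fin n → ℕ) i → x i ≤ sum x
summand-≤ x zero    = m≤m+n (x zero) _
summand-≤ x (suc i) = ≤-trans (summand-≤ (x ∘ suc) i) (m≤n+m _ (x zero))

module _ (G : Graph) {m} (c : Fin m → Vertex G) where

  pattern-code : Vertex G → Fin (2 ^ m)
  pattern-code v = encodeBits λ i → adj G (c i) v

  -- Colours are grouped by the set S of patterns they occur on, and x S is
  -- the number of colours in the group.
  record Valid (k : ℕ) (x : Fin (2 ^ (2 ^ m)) → ℕ) : Set where
    field
      demand : ∀ t → count (λ v → does (pattern-code v ≟ t)) ≤ sum (λ S → x S * 𝟙 (bit S t))
      stable : ∀ S u v → x S ≢ 0 → bit S (pattern-code u) ≡ true → bit S (pattern-code v) ≡ true →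
        pattern-code u ≢ pattern-code v → adj G u v ≡ false
      budget : sum x ≤ k

  -- `spread x` attaches a set of patterns to every colour. By `demand` each class of equal patterns
  -- injects into the colours whose set contains its pattern; vertices of different classes sharing
  -- a colour are nonadjacent by `stable`.
  valid⇒colorable : ∀ {k x} → Valid k x → Colorable G k
  valid⇒colorable {k} {x} valid = f , proper
    where
    open Valid valid

    class : Fin (2 ^ m) → Vertex G → Bool
    class t v = does (pattern-code v ≟ t)

    usable : Fin (2 ^ m) → Fin (sum x) → Bool
    usable t p = bit (spread x p) t

    enough : ∀ t → count (class t) ≤ count (usable t)
    enough t = ≤-trans (demand t) (≤-reflexive (sym (sum-spread x λ S → 𝟙 (bit S t))))

    -- `t` is a separate argument, so that an equation between patterns can be matched with `refl`
    -- when colours are compared.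
    colour : ∀ t v → pattern-code v ≡ t → Fin (sum x)
    colour t v eq = match (class t) (usable t) (enough t) v (dec-true (pattern-code v ≟ t) eq)

    g : Vertex G → Fin (sum x)
    g v = colour (pattern-code v) v refl

    g-usable : ∀ v → usable (pattern-code v) (g v) ≡ true
    g-usable v = match-sound (class (pattern-code v)) (usable _) (enough _) v _

    g-injective : ∀ u v → pattern-code u ≡ pattern-code v → g u ≡ g v → u ≡ v
    g-injective u v eq gu≡gv = match-injective (class _) (usable _) (enough _) _ _
      (trans (sym (colour-≡ eq)) gu≡gv)
      where
      colour-≡ : ∀ {t} (eq : pattern-code u ≡ t) → g u ≡ colour t u eq
      colour-≡ refl = refl

    f : Vertex G → Fin k
    f v = inject≤ (g v) budget

    proper : IsColoring G k f
    proper u v uv fu≡fv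
      with inject≤-injective budget budget (g u) (g v) fu≡fv | pattern-code u ≟ pattern-code v
    ... | gu≡gv | yes eq = subst T
      (trans (cong (adj G u) (sym (g-injective u v eq gu≡gv))) (Graph.irrefl G u)) uv
    ... | gu≡gv | no ne  = subst T (stable (spread x (g v)) u v (spread-occurs x (g v))
      (subst (λ p → usable (pattern-code u) p ≡ true) gu≡gv (g-usable u)) (g-usable v) ne) uv

  module _ (determine : PatternsDetermine G c) where

    same-code : ∀ {u v} → pattern-code u ≡ pattern-code v → SamePattern G c u v
    same-code eq i = trans (sym (bit-encodeBits _ i)) (trans (cong (λ t → bit t i) eq) (bit-encodeBits _ i))

    -- The code of `v` differs from that of `u` and `u′`, so `v` is a third vertex, on which twins
    -- agree.
    same-code-adj : ∀ {u u′ v} → pattern-code u ≡ pattern-code u′ → pattern-code u ≢ pattern-code v →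
      adj G u v ≡ adj G u′ v
    same-code-adj {u} {u′} {v} eq ne with u ≟ u′
    ... | yes refl = refl
    ... | no u≢u′  = proj₂ (determine u u′ u≢u′ (same-code eq)) v
      (λ { refl → ne refl }) (λ { refl → ne eq })

    -- Each colour is grouped by the patterns it occurs on. Vertices of equal pattern are adjacent,
    -- hence need distinct colours, which gives `demand`. For `stable`, a colour of group `S` occurs
    -- on representatives of both patterns; these are nonadjacent, and twins transfer this to `u`
    -- and `v`.
    colorable⇒valid : ∀ {k} → Colorable G k → ∃[ x ] Valid k x
    colorable⇒valid {k} (f , proper) = fibre group , record
      { demand = λ t → ≤-trans (demand t) (≤-reflexive (sym (sum-fibre group λ S → 𝟙 (bit S t))))
      ; stable = stable
      ; budget = ≤-reflexive (trans (sum-cong-≗ λ S → sym (*-identityʳ (fibre group S)))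
          (trans (sum-fibre group λ _ → 1) (trans (sum-constant k 1) (*-identityʳ k))))
      }
      where
      occurs? : ∀ c t → Dec (∃[ v ] pattern-code v ≡ t × f v ≡ c)
      occurs? c t = any? λ v → pattern-code v ≟ t ×-dec f v ≟ c

      group : Fin k → Fin (2 ^ (2 ^ m))
      group c = encodeBits λ t → does (occurs? c t)

      bit-group : ∀ c t → bit (group c) t ≡ does (occurs? c t)
      bit-group c = bit-encodeBits λ t → does (occurs? c t)

      clash : ∀ {u v} → adj G u v ≡ true → f u ≢ f v
      clash eq = proper _ _ (Equivalence.from Bool.T-≡ eq)

      demand : ∀ t → count (λ v → does (pattern-code v ≟ t)) ≤ count (λ c → bit (group c) t)
      demand t = count-injection _ _ f
        (λ v v∈ → trans (bit-group (f v) t) (dec-true (occurs? (f v) t) (v , does⇒ (_ ≟ t) v∈ , refl)))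
        (λ {u} {v} u∈ v∈ fu≡fv → decidable-stable (u ≟ v) λ u≢v →
          clash (proj₁ (determine u v u≢v
            (same-code (trans (does⇒ (_ ≟ t) u∈) (sym (does⇒ (_ ≟ t) v∈)))))) fu≡fv)

      stable : ∀ S u v → fibre group S ≢ 0 →
        bit S (pattern-code u) ≡ true → bit S (pattern-code v) ≡ true →
        pattern-code u ≢ pattern-code v → adj G u v ≡ false
      stable S u v S≢0 u∈ v∈ ne with sum-≢0 _ S≢0
      ... | c , c≢0 with group c ≟ S
      ...   | no _ = contradiction refl c≢0
      ...   | yes refl
        with does⇒ (occurs? c _) (trans (sym (bit-group c _)) u∈)
           | does⇒ (occurs? c _) (trans (sym (bit-group c _)) v∈)
      ...     | u′ , u′~u , fu′ | v′ , v′~v , fv′ = begin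
        adj G u v    ≡⟨ same-code-adj (sym u′~u) ne ⟩
        adj G u′ v   ≡⟨ Graph.sym G u′ v ⟩
        adj G v u′   ≡⟨ same-code-adj (sym v′~v) (λ eq → ne (sym (trans eq u′~u))) ⟩
        adj G v′ u′  ≡⟨ Bool.¬-not (λ eq → clash eq (trans fv′ (sym fu′))) ⟩
        false        ∎
        where open ≡-Reasoning

-- The chromatic number as an arithmetic term

-- An unrolled sum over an index set independent of the graph: it enlarges the program but adds no
-- loop, unlike `∑ᵗ`.
sumᵗ : ∀ {d} n → (Fin n → Term d) → Term d
sumᵗ zero    e = lit 0
sumᵗ (suc n) e = e zero ⊞ sumᵗ n (e ∘ suc)

eval-sumᵗ : ∀ {d} n (e : Fin n → Term d) {f M ρ} → (∀ i → eval (e i) M ρ ≡ f i) →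
  eval (sumᵗ n e) M ρ ≡ sum f
eval-sumᵗ zero    e e≗f = refl
eval-sumᵗ (suc n) e e≗f = cong₂ _+_ (e≗f zero) (eval-sumᵗ n (e ∘ suc) (e≗f ∘ suc))

-- Bounded existential quantification: a sum of naturals is nonzero iff some summand is.
quantify : ∀ {d} n → Term (n + d) → Term d
quantify zero    e = e
quantify (suc n) e = quantify n (∑ᵗ e)

sumTo-≢0 : ∀ n f → sumTo n f ≢ 0 → ∃[ i ] i < n × f i ≢ 0
sumTo-≢0 zero    f s≢0 = contradiction refl s≢0
sumTo-≢0 (suc n) f s≢0 with f n in eq
... | suc _ = n , n<1+n n , λ fn≡0 → contradiction (trans (sym eq) fn≡0) λ ()
... | zero  with sumTo-≢0 n f (s≢0 ∘ trans (+-identityʳ _))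
...   | i , i<n , fi≢0 = i , m<n⇒m<1+n i<n , fi≢0

sumTo≡0⇒ : ∀ n f → sumTo n f ≡ 0 → ∀ i → i < n → f i ≡ 0
sumTo≡0⇒ n f s≡0 i i<n = subst (λ j → f j ≡ 0) (toℕ-fromℕ< i<n)
  (sum≡0⇒ (f ∘ toℕ) (trans (sym (sumTo-sum n f)) s≡0) (fromℕ< i<n))

quantify-≢0 : ∀ {d} n (e : Term (n + d)) {M ρ} → eval (quantify n e) M ρ ≢ 0 →
  ∃[ g ] (∀ i → lookup g i < M 0) × eval e M (g ++ ρ) ≢ 0
quantify-≢0 zero    e q≢0 = [] , (λ ()) , q≢0
quantify-≢0 (suc n) e {M} q≢0 with quantify-≢0 n (∑ᵗ e) q≢0
... | g , g< , s≢0 with sumTo-≢0 (M 0) _ s≢0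
... | i , i< , e≢0 = i ∷ g , (λ { zero → i< ; (suc j) → g< j }) , e≢0

≢0-quantify : ∀ {d} n (e : Term (n + d)) {M ρ} (g : Vec ℕ n) → (∀ i → lookup g i < M 0) →
  eval e M (g ++ ρ) ≢ 0 → eval (quantify n e) M ρ ≢ 0
≢0-quantify zero    e []      g< e≢0 = e≢0
≢0-quantify (suc n) e {M} (i ∷ g) g< e≢0 =
  ≢0-quantify n (∑ᵗ e) g (g< ∘ suc) λ s≡0 → e≢0 (sumTo≡0⇒ (M 0) _ s≡0 i (g< zero))

guarded : ∀ {d} → Bool → Term d → Term d
guarded b e = if b then e else lit 0

-- The adjacency matrix starts at address 1, and the n-fold sum stands for
-- multiplication of the row number by n.
adjᵗ : ∀ {d} → Fin d → Fin d → Term d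
adjᵗ i j = at (lit 1 ⊞ ∑ᵗ (var (suc i)) ⊞ var j)

-- The inner sum counts disagreements with `t`, so the term is the indicator of having pattern `t`.
matchesᵗ : ∀ {d m} → (Fin m → Fin d) → Fin d → Fin (2 ^ m) → Term d
matchesᵗ {m = m} cs j t = lit 1 ⊟ sumᵗ m λ i →
  if bit t i then lit 1 ⊟ adjᵗ (cs i) j else adjᵗ (cs i) j

distinctMembers? : ∀ {m} S (s t : Fin (2 ^ m)) → Dec (bit S s ≡ true × bit S t ≡ true × s ≢ t)
distinctMembers? S s t = bit S s Bool.≟ true ×-dec bit S t Bool.≟ true ×-dec ¬? (s ≟ t)

-- The terms demandᵗ, stableᵗ and budgetᵗ vanish iff the conditions of Valid hold.
module _ {d m} (cs : Fin m → Fin d) (xs : Fin (2 ^ (2 ^ m)) → Fin d) where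

  demandᵗ : Fin (2 ^ m) → Term d
  demandᵗ t = ∑ᵗ (matchesᵗ (suc ∘ cs) zero t)
    ⊟ sumᵗ (2 ^ (2 ^ m)) λ S → guarded (bit S t) (var (xs S))

  -- 1 ∸ Σ (1 ∸ aᵢ) vanishes iff some aᵢ does.
  clashᵗ : Fin (2 ^ (2 ^ m)) → Fin (2 ^ m) → Fin (2 ^ m) → Term (suc (suc d))
  clashᵗ S s t = lit 1 ⊟
    ( (lit 1 ⊟ var (suc (suc (xs S))))
    ⊞ (lit 1 ⊟ matchesᵗ (λ i → suc (suc (cs i))) (suc zero) s)
    ⊞ (lit 1 ⊟ matchesᵗ (λ i → suc (suc (cs i))) zero t)
    ⊞ (lit 1 ⊟ adjᵗ (suc zero) zero))

  stableᵗ : Fin (2 ^ (2 ^ m)) → Fin (2 ^ m) → Fin (2 ^ m) → Term d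
  stableᵗ S s t = guarded (does (distinctMembers? {m} S s t)) (∑ᵗ (∑ᵗ (clashᵗ S s t)))

  budgetᵗ : Fin d → Term d
  budgetᵗ k = sumᵗ (2 ^ (2 ^ m)) (var ∘ xs) ⊟ var k

  violationsᵗ : Fin d → Term d
  violationsᵗ k = sumᵗ (2 ^ m) demandᵗ
    ⊞ (sumᵗ (2 ^ (2 ^ m)) λ S → sumᵗ (2 ^ m) λ s → sumᵗ (2 ^ m) λ t → stableᵗ S s t)
    ⊞ budgetᵗ k

-- The chromatic number is the number of all k < n such that the graph is not
-- k-colourable.  Since k < n, the bounds x S < n exclude no solution x.
chromaticᵗ : ℕ → Term 0
chromaticᵗ m = ∑ᵗ (lit 1 ⊟ quantify m (quantify (2 ^ (2 ^ m))
  -- Inner binders come first in the environment: the values of `x`, then those of `c`, and `k`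
  -- last.
  (lit 1 ⊟ violationsᵗ (λ i → 2 ^ (2 ^ m) ↑ʳ (i ↑ˡ 1)) (λ S → S ↑ˡ (m + 1))
    (2 ^ (2 ^ m) ↑ʳ (m ↑ʳ zero)))))

-- Correctness of the term for the chromatic number

implied : ∀ a b c d → 1 ∸ ((1 ∸ a) + (1 ∸ b) + (1 ∸ c) + (1 ∸ d)) ≡ 0 →
  a ≢ 0 → b ≢ 0 → c ≢ 0 → d ≡ 0
implied a b c zero eq _ _ _ = refl
implied zero b c (suc d) eq a≢0 _ _ = contradiction refl a≢0
implied (suc a) zero c (suc d) eq _ b≢0 _ = contradiction refl b≢0
implied (suc a) (suc b) zero (suc d) eq _ _ c≢0 = contradiction refl c≢0
implied (suc a) (suc b) (suc c) (suc d) eq _ _ _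
  rewrite 0∸n≡0 a | 0∸n≡0 b | 0∸n≡0 c | 0∸n≡0 d = contradiction eq λ ()

implies : ∀ a b c d → (a ≢ 0 → b ≢ 0 → c ≢ 0 → d ≡ 0) →
  1 ∸ ((1 ∸ a) + (1 ∸ b) + (1 ∸ c) + (1 ∸ d)) ≡ 0
implies zero b c d imp = 0∸n≡0 ((1 ∸ b) + (1 ∸ c) + (1 ∸ d))
implies (suc a) zero c d imp rewrite 0∸n≡0 a = 0∸n≡0 ((1 ∸ c) + (1 ∸ d))
implies (suc a) (suc b) zero d imp rewrite 0∸n≡0 a | 0∸n≡0 b = 0∸n≡0 (1 ∸ d)
implies (suc a) (suc b) (suc c) d imp
  rewrite 0∸n≡0 a | 0∸n≡0 b | 0∸n≡0 c | imp (λ ()) (λ ()) (λ ()) = refl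

𝟙-≢0 : ∀ {b} → 𝟙 b ≢ 0 → b ≡ true
𝟙-≢0 {true}  _  = refl
𝟙-≢0 {false} ne = contradiction refl ne

𝟙≡0 : ∀ {b} → 𝟙 b ≡ 0 → b ≡ false
𝟙≡0 {false} _ = refl

module _ (G : Graph) where

  private
    M = load (encode G)

    sumTo-const : ∀ n x → sumTo n (λ _ → x) ≡ x * n
    sumTo-const n x = trans (sumTo-sum n (λ _ → x)) (trans (sum-constant n x) (*-comm n x))

  eval-adjᵗ : ∀ {d} (ρ : Vec ℕ d) i j u v → lookup ρ i ≡ toℕ u → lookup ρ j ≡ toℕ v →
    eval (adjᵗ i j) M ρ ≡ 𝟙 (adj G u v)
  eval-adjᵗ ρ i j u v ρi ρj rewrite ρi | ρj | sumTo-const (order G) (toℕ u) =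
    load-product (λ u v → 𝟙 (adj G u v)) id u v

  module _ {m} (c : Fin m → Vertex G) where

    -- The disagreements sum to zero iff all bits agree, and a number below `2 ^ m` is determined by
    -- its bits.
    eval-matchesᵗ : ∀ {d} (ρ : Vec ℕ d) (cs : Fin m → Fin d) j v t →
      (∀ i → lookup ρ (cs i) ≡ toℕ (c i)) → lookup ρ j ≡ toℕ v →
      eval (matchesᵗ cs j t) M ρ ≡ 𝟙 (does (pattern-code G c v ≟ t))
    eval-matchesᵗ ρ cs j v t ρc ρj = trans (cong (1 ∸_) (eval-sumᵗ m mismatchᵗ λ _ → refl)) go
      where
      mismatchᵗ = λ i → if bit t i then lit 1 ⊟ adjᵗ (cs i) j else adjᵗ (cs i) j

      mismatch : Fin m → ℕ
      mismatch i = eval (mismatchᵗ i) M ρ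

      agree⇒ : ∀ i → adj G (c i) v ≡ bit t i → mismatch i ≡ 0
      agree⇒ i eq with bit t i
      ... | true  rewrite eval-adjᵗ ρ (cs i) j (c i) v (ρc i) ρj | eq = refl
      ... | false rewrite eval-adjᵗ ρ (cs i) j (c i) v (ρc i) ρj | eq = refl

      ⇒agree : ∀ i → mismatch i ≡ 0 → adj G (c i) v ≡ bit t i
      ⇒agree i eq with bit t i
      ... | true  rewrite eval-adjᵗ ρ (cs i) j (c i) v (ρc i) ρj with adj G (c i) v
      ...   | true = refl
      ⇒agree i eq | false rewrite eval-adjᵗ ρ (cs i) j (c i) v (ρc i) ρj = 𝟙≡0 eq

      go : 1 ∸ sum mismatch ≡ 𝟙 (does (pattern-code G c v ≟ t))
      go with pattern-code G c v ≟ t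
      ... | yes refl = cong (1 ∸_) (⇒sum≡0 mismatch λ i →
        agree⇒ i (sym (bit-encodeBits (λ i → adj G (c i) v) i)))
      ... | no ne with sum mismatch in eq
      ...   | zero  = contradiction (encodeBits-bit t (λ i → ⇒agree i (sum≡0⇒ mismatch eq i))) ne
      ...   | suc s = 0∸n≡0 s

    module _ {d} (ρ : Vec ℕ d) (cs : Fin m → Fin d) (xs : Fin (2 ^ (2 ^ m)) → Fin d) (k : Fin d)
             (ρc : ∀ i → lookup ρ (cs i) ≡ toℕ (c i)) where

      private
        x : Fin (2 ^ (2 ^ m)) → ℕ
        x S = lookup ρ (xs S)

      eval-demandᵗ : ∀ t → eval (demandᵗ cs xs t) M ρ ≡
        count (λ v → does (pattern-code G c v ≟ t)) ∸ sum (λ S → x S * 𝟙 (bit S t))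
      eval-demandᵗ t = cong₂ _∸_
        (trans (sumTo-sum (order G) _) (sum-cong-≗ λ v →
          eval-matchesᵗ (toℕ v ∷ ρ) (suc ∘ cs) zero v t ρc refl))
        (eval-sumᵗ (2 ^ (2 ^ m)) (λ S → guarded (bit S t) (var (xs S))) guarded-*)
        where
        guarded-* : ∀ S → eval (guarded (bit S t) (var (xs S))) M ρ ≡ x S * 𝟙 (bit S t)
        guarded-* S with bit S t
        ... | true  = sym (*-identityʳ (x S))
        ... | false = sym (*-zeroʳ (x S))

      eval-budgetᵗ : eval (budgetᵗ cs xs k) M ρ ≡ sum x ∸ lookup ρ k
      eval-budgetᵗ = cong (_∸ lookup ρ k) (eval-sumᵗ (2 ^ (2 ^ m)) (var ∘ xs) λ _ → refl)

      clashes : ∀ (S : Fin (2 ^ (2 ^ m))) (s t : Fin (2 ^ m)) (u v : Vertex G) → ℕ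
      clashes S s t u v = 1 ∸
        ( (1 ∸ x S)
        + (1 ∸ 𝟙 (does (pattern-code G c u ≟ s)))
        + (1 ∸ 𝟙 (does (pattern-code G c v ≟ t)))
        + (1 ∸ 𝟙 (adj G u v)))

      eval-clashᵗ : ∀ S s t u v → eval (clashᵗ cs xs S s t) M (toℕ v ∷ toℕ u ∷ ρ) ≡ clashes S s t u v
      eval-clashᵗ S s t u v
        rewrite eval-matchesᵗ (toℕ v ∷ toℕ u ∷ ρ) (λ i → suc (suc (cs i))) (suc zero) u s ρc refl
              | eval-matchesᵗ (toℕ v ∷ toℕ u ∷ ρ) (λ i → suc (suc (cs i))) zero v t ρc refl
              | eval-adjᵗ (toℕ v ∷ toℕ u ∷ ρ) (suc zero) zero u v refl refl = refl

      eval-stableᵗ : ∀ S s t → does (distinctMembers? {m} S s t) ≡ true →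
        eval (stableᵗ cs xs S s t) M ρ ≡ sum λ u → sum λ v → clashes S s t u v
      eval-stableᵗ S s t eq rewrite eq = trans (sumTo-sum (order G) _) (sum-cong-≗ λ u →
        trans (sumTo-sum (order G) _) (sum-cong-≗ λ v → eval-clashᵗ S s t u v))

      eval-violationsᵗ : eval (violationsᵗ cs xs k) M ρ ≡
        sum (λ t → eval (demandᵗ cs xs t) M ρ)
        + sum (λ S → sum λ s → sum λ t → eval (stableᵗ cs xs S s t) M ρ)
        + eval (budgetᵗ cs xs k) M ρ
      eval-violationsᵗ = cong (_+ eval (budgetᵗ cs xs k) M ρ) (cong₂ _+_
        (eval-sumᵗ (2 ^ m) (demandᵗ cs xs) λ _ → refl)
        (eval-sumᵗ (2 ^ (2 ^ m)) (λ S → sumᵗ (2 ^ m) λ s → sumᵗ (2 ^ m) (stableᵗ cs xs S s)) λ S →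
          eval-sumᵗ (2 ^ m) (λ s → sumᵗ (2 ^ m) (stableᵗ cs xs S s)) λ s →
          eval-sumᵗ (2 ^ m) (stableᵗ cs xs S s) λ _ → refl))

      -- A sum of naturals vanishes only if every summand does, and a truncated difference vanishes
      -- only if the inequality holds. For `stable` the relevant summand is the one at the codes of
      -- `u` and `v`.
      no-violations⇒valid : eval (violationsᵗ cs xs k) M ρ ≡ 0 → Valid G c (lookup ρ k) x
      no-violations⇒valid eq = record
        { demand = λ t → m∸n≡0⇒m≤n (trans (sym (eval-demandᵗ t)) (sum≡0⇒ _ demand≡0 t))
        ; stable = λ S u v xS≢0 u∈ v∈ ne →
            let s = pattern-code G c u
                t = pattern-code G c v
                stable-S≡0 = sum≡0⇒ _ (sum≡0⇒ _ (sum≡0⇒ _ stable≡0 S) s) t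
                clash≡0 = sum≡0⇒ _ (sum≡0⇒ _ (trans (sym (eval-stableᵗ S s t
                            (dec-true (distinctMembers? {m} S s t) (u∈ , v∈ , ne)))) stable-S≡0) u) v
            in 𝟙≡0 (implied (x S) _ _ _ clash≡0 xS≢0 (𝟙-does (s ≟ s) refl) (𝟙-does (t ≟ t) refl))
        ; budget = m∸n≡0⇒m≤n (trans (sym eval-budgetᵗ) budget≡0)
        }
        where
        total≡0 = trans (sym eval-violationsᵗ) eq
        budget≡0 = m+n≡0⇒n≡0 (sum (λ t → eval (demandᵗ cs xs t) M ρ)
          + sum (λ S → sum λ s → sum λ t → eval (stableᵗ cs xs S s t) M ρ)) total≡0
        rest≡0 = m+n≡0⇒m≡0 (sum (λ t → eval (demandᵗ cs xs t) M ρ)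
          + sum (λ S → sum λ s → sum λ t → eval (stableᵗ cs xs S s t) M ρ)) total≡0
        demand≡0 = m+n≡0⇒m≡0 (sum (λ t → eval (demandᵗ cs xs t) M ρ)) rest≡0
        stable≡0 = m+n≡0⇒n≡0 (sum (λ t → eval (demandᵗ cs xs t) M ρ)) rest≡0

        𝟙-does : ∀ {A : Set} (d : Dec A) → A → 𝟙 (does d) ≢ 0
        𝟙-does d a eq rewrite dec-true d a = contradiction eq λ ()

      valid⇒no-violations : Valid G c (lookup ρ k) x → eval (violationsᵗ cs xs k) M ρ ≡ 0
      valid⇒no-violations valid = trans eval-violationsᵗ (cong₂ _+_ (cong₂ _+_
        (⇒sum≡0 _ λ t → trans (eval-demandᵗ t) (m≤n⇒m∸n≡0 (demand t)))
        (⇒sum≡0 _ λ S → ⇒sum≡0 _ λ s → ⇒sum≡0 _ λ t → stable≡0 S s t))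
        (trans eval-budgetᵗ (m≤n⇒m∸n≡0 budget)))
        where
        open Valid valid

        stable≡0 : ∀ S s t → eval (stableᵗ cs xs S s t) M ρ ≡ 0
        stable≡0 S s t = by-guard (does (distinctMembers? {m} S s t)) refl
          where
          clash≡0 : bit S s ≡ true × bit S t ≡ true × s ≢ t → ∀ u v → clashes S s t u v ≡ 0
          clash≡0 (s∈ , t∈ , s≢t) u v = implies (x S) _ _ _ λ xS≢0 u~s v~t →
            let us = does⇒ (_ ≟ s) (𝟙-≢0 u~s)
                vt = does⇒ (_ ≟ t) (𝟙-≢0 v~t)
            in cong 𝟙 (stable S u v xS≢0
                 (trans (cong (bit S) us) s∈) (trans (cong (bit S) vt) t∈)
                 λ eq → s≢t (trans (sym us) (trans eq vt)))

          by-guard : ∀ b → does (distinctMembers? {m} S s t) ≡ b → eval (stableᵗ cs xs S s t) M ρ ≡ 0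
          by-guard false eq = cong (λ b → eval (guarded b (∑ᵗ (∑ᵗ (clashᵗ cs xs S s t)))) M ρ) eq
          by-guard true  eq = trans (eval-stableᵗ S s t eq)
            (⇒sum≡0 _ λ u → ⇒sum≡0 _ λ v → clash≡0 (does⇒ (distinctMembers? {m} S s t) eq) u v)

  Valid-cong : ∀ {m} {c : Fin m → Vertex G} {k k′ x x′} → k ≡ k′ → (∀ S → x S ≡ x′ S) →
    Valid G c k x → Valid G c k′ x′
  Valid-cong refl x≗ valid = record
    { demand = λ t → ≤-trans (demand t) (≤-reflexive (sum-cong-≗ λ S → cong (_* 𝟙 (bit S t)) (x≗ S)))
    ; stable = λ S u v x′S≢0 → stable S u v (x′S≢0 ∘ trans (sym (x≗ S)))
    ; budget = ≤-trans (≤-reflexive (sum-cong-≗ (sym ∘ x≗))) budget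
    } where open Valid valid

  Colorable-mono : ∀ {i j} → i ≤ j → Colorable G i → Colorable G j
  Colorable-mono i≤j (f , proper) = (λ v → inject≤ (f v) i≤j) , λ u v uv eq →
    proper u v uv (inject≤-injective i≤j i≤j _ _ eq)

  Colorable-order : Colorable G (order G)
  Colorable-order = id , λ { u .u uu refl → subst T (Graph.irrefl G u) uu }

  module _ {m : ℕ} where

    private
      N = 2 ^ (2 ^ m)
      cs : Fin m → Fin (N + (m + 1))
      cs i = N ↑ʳ (i ↑ˡ 1)
      xs : Fin N → Fin (N + (m + 1))
      xs S = S ↑ˡ (m + 1)
      kᵗ : Fin (N + (m + 1))
      kᵗ = N ↑ʳ (m ↑ʳ zero)

      colorableᵗ : Term 1
      colorableᵗ = quantify m (quantify N (lit 1 ⊟ violationsᵗ cs xs kᵗ))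

      module _ (gx : Vec ℕ N) (gc : Vec ℕ m) (k : ℕ) where
        ρ = gx ++ (gc ++ (k ∷ []))
        lookup-cs : ∀ i → lookup ρ (cs i) ≡ lookup gc i
        lookup-cs i = trans (lookup-++ʳ gx _ (i ↑ˡ 1)) (lookup-++ˡ gc _ i)
        lookup-xs : ∀ S → lookup ρ (xs S) ≡ lookup gx S
        lookup-xs S = lookup-++ˡ gx _ S
        lookup-k : lookup ρ kᵗ ≡ k
        lookup-k = trans (lookup-++ʳ gx _ (m ↑ʳ zero)) (lookup-++ʳ gc _ zero)

    -- The search may succeed at any `m` vertices, not only at an induced cycle; valid counts over
    -- any of them give a colouring.
    colorableᵗ-sound : ∀ k → eval colorableᵗ M (k ∷ []) ≢ 0 → Colorable G k
    colorableᵗ-sound k q≢0 with quantify-≢0 m _ q≢0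
    ... | gc , gc< , q′≢0 with quantify-≢0 N _ q′≢0
    ... | gx , _ , v≢0 = subst (Colorable G) (lookup-k gx gc k) (valid⇒colorable G c
        (no-violations⇒valid c (ρ gx gc k) cs xs kᵗ
          (λ i → trans (lookup-cs gx gc k i) (sym (toℕ-fromℕ< (gc< i))))
          (1∸-≢0 v≢0)))
      where
      c : Fin m → Vertex G
      c i = fromℕ< (gc< i)
      1∸-≢0 : ∀ {a} → 1 ∸ a ≢ 0 → a ≡ 0
      1∸-≢0 {zero}  _  = refl
      1∸-≢0 {suc a} ne = contradiction (0∸n≡0 a) ne

    module _ (c : Fin m → Vertex G) (determine : PatternsDetermine G c) where

      colorableᵗ-complete : ∀ k → k < order G → Colorable G k → eval colorableᵗ M (k ∷ []) ≢ 0
      colorableᵗ-complete k k<n colorable with colorable⇒valid G c determine colorable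
      ... | x , valid = ≢0-quantify m _ gc
        (λ i → subst (_< order G) (sym (lookup∘tabulate _ i)) (toℕ<n (c i)))
        (≢0-quantify N _ gx
          (λ S → subst (_< order G) (sym (lookup∘tabulate x S))
            (≤-<-trans (≤-trans (summand-≤ x S) (Valid.budget valid)) k<n))
          λ eq → contradiction (trans (sym (cong (1 ∸_) no-violations)) eq) λ ())
        where
        gc = tabulate (toℕ ∘ c)
        gx = tabulate x
        no-violations : eval (violationsᵗ cs xs kᵗ) M (ρ gx gc k) ≡ 0
        no-violations = valid⇒no-violations c (ρ gx gc k) cs xs kᵗ
          (λ i → trans (lookup-cs gx gc k i) (lookup∘tabulate (toℕ ∘ c) i))
          (Valid-cong (sym (lookup-k gx gc k))
            (λ S → sym (trans (lookup-xs gx gc k S) (lookup∘tabulate x S))) valid)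

      -- Colourability is monotone in the number of colours and holds at the order, so
      -- `least-natural` applies.
      chromaticᵗ-correct : IsChromaticNumber G (eval (chromaticᵗ m) M [])
      chromaticᵗ-correct = least-natural (Colorable G) Colorable-mono
        (λ k → 1 ∸ eval colorableᵗ M (k ∷ [])) (order G) decide Colorable-order
        where
        decide : ∀ k → k < order G →
          (Colorable G k × 1 ∸ eval colorableᵗ M (k ∷ []) ≡ 0) ⊎
          (¬ Colorable G k × 1 ∸ eval colorableᵗ M (k ∷ []) ≡ 1)
        decide k k<n with eval colorableᵗ M (k ∷ []) in eq
        ... | zero  = inj₂ ((λ col → colorableᵗ-complete k k<n col eq) , refl)
        ... | suc q = inj₁ (colorableᵗ-sound k (λ eq′ → contradiction (trans (sym eq) eq′) λ ()) , 0∸n≡0 q)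

-- `m` is fixed before the graph, so one program and one polynomial serve the class. The vertices
-- `c` only have to exist; the program searches for them.
patterns-solvable : ∀ m {Class} →
  (∀ G → Class G → ∃[ c ] PatternsDetermine G {m} c) →
  SolvableInPolynomialTime VertexColoring Class
patterns-solvable m patterns = term-solvable {VertexColoring} (chromaticᵗ m) λ G G∈ →
  let c , determine = patterns G G∈ in chromaticᵗ-correct G c determine

theorem2p4 : SolvableInPolynomialTime VertexColoring
    (λ G → Free (4 K₁ ∷ C 4 ∷ C 6 ∷ []) G × C 7 ⊑ G)
theorem2p4 = patterns-solvable 7 λ G (free , C7⊑G) →
  proj₁ C7⊑G , C7-patterns-determine G free C7⊑G
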